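{- For all constants $\alpha\ge1$ and $\beta\ge1$, there is an unrelated-machines instance with interval uncertainty, two machines and one job (i.e. an interval uncertainty set $\mathcal U$ together with a predicted scenario $\hat q\in\mathcal U$) such that no randomized algorithm is both $\alpha$-consistent and $\beta$-robust on it; that is, there is no random schedule $\mathcal S$ with $$\mathbb E[C_{\max}(\mathcal S,\hat q)]\le\alpha\,\mathrm{OPT}(\hat q)\quad\text{and}\quad \mathbb E[C_{\max}(\mathcal S,q)]\le\beta\,\mathrm{OPT}^{\mathrm{rob}}(\mathcal U)\ \text{ for all } q\in\mathcal U.$$
   Context: There are $m$ machines and $n$ jobs. A scenario is a matrix $q\in\mathbb R_{\ge0}^{m\times n}$, where $q_{i,j}$ is the processing time of job $j$ on machine $i$ (unrelated machines). A schedule is a partition $\mathcal S=(S_1,\dots,S_m)$ of $[n]$ (parts may be empty), and $C_{\max}(\mathcal S,q)=\max_{i}\sum_{j\in S_i}q_{i,j}$. $\mathrm{OPT}(q)=\min_{\mathcal S}C_{\max}(\mathcal S,q)$ and $\mathrm{OPT}^{\mathrm{rob}}(\mathcal U)=\min_{\mathcal S}\max_{q\in\mathcal U}C_{\max}(\mathcal S,q)$, minima over deterministic schedules. Interval uncertainty on unrelated machines: for given $0\le q^-_{i,j}\le q^+_{i,j}$, $\mathcal U=\{q: q_{i,j}\in[q^-_{i,j},q^+_{i,j}]\ \forall i,j\}$. A randomized algorithm returns, on input $(\mathcal U,\hat q)$, a random schedule (a probability distribution over schedules); its consistency and robustness are measured in expectation, with the scenario $q$ chosen independently of the algorithm's randomness.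 -}

module Defs where

open import Level using (0ℓ)
open import Data.Bool.Base using (if_then_else_)
open import Data.Fin.Base using (Fin)
open import Data.Fin.Subset using (Subset) renaming (_∈_ to _∈ˢ_)
open import Data.Nat.Base as ℕ using (ℕ; suc)
import Data.Nat.Properties as ℕ
open import Data.Product.Base using (∃; _×_; _,_; proj₁; proj₂)
open import Data.Product using (∃!)
open import Data.Rational.Base as ℚ using (ℚ; 0ℚ; 1ℚ; ½; ∣_∣)
import Data.Rational.Properties as ℚ
open import Data.Rational.Solver using (module +-*-Solver)
open import Data.Sum.Base using (inj₁; inj₂)
open import Data.Vec.Base using (lookup)
open import Data.Vec.Functional using (Vector; foldr; head; tail)
open import Relation.Binary.PropositionalEquality
  using (_≡_; refl; sym; trans; cong; cong₂; subst; subst₂; module ≡-Reasoning)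
open import Relation.Unary using (Pred; _∈_)

------------------------------------------------------------------------
-- Real numbers, as Cauchy sequences of rationals with a modulus of
-- convergence.  Equality of reals is the setoid equality _≈_ below, and all
-- operations act termwise.

IsCauchy : (ℕ → ℚ) → Set
IsCauchy x = ∀ ε → 0ℚ ℚ.< ε →
  ∃ λ N → ∀ k l → N ℕ.≤ k → N ℕ.≤ l → ∣ x k ℚ.- x l ∣ ℚ.≤ ε

record ℝ : Set where
  constructor mkℝ
  field
    seq      : ℕ → ℚ
    isCauchy : IsCauchy seq

open ℝ public

infix 4 _≤_ _≈_

_≤_ : ℝ → ℝ → Set
x ≤ y = ∀ ε → 0ℚ ℚ.< ε →
  ∃ λ N → ∀ k → N ℕ.≤ k → seq x k ℚ.≤ seq y k ℚ.+ ε

_≈_ : ℝ → ℝ → Set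
x ≈ y = x ≤ y × y ≤ x

-- Abstract because unfolding these proofs makes type checking very slow.
private
  abstract
    p≤∣p∣ : ∀ p → p ℚ.≤ ∣ p ∣
    p≤∣p∣ p with ℚ.≤-total 0ℚ p
    ... | inj₁ 0≤p = ℚ.≤-reflexive (sym (ℚ.0≤p⇒∣p∣≡p 0≤p))
    ... | inj₂ p≤0 = ℚ.≤-trans p≤0 (ℚ.0≤∣p∣ p)

    ∣-∣≤⇒≤ : ∀ p q {ε} → ∣ p ℚ.- q ∣ ℚ.≤ ε → p ℚ.≤ q ℚ.+ ε
    ∣-∣≤⇒≤ p q {ε} h = subst (ℚ._≤ q ℚ.+ ε)
      (solve 2 (λ p q → q :+ (p :- q) := p) refl p q)
      (ℚ.+-monoʳ-≤ q (ℚ.≤-trans (p≤∣p∣ (p ℚ.- q)) h))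
      where open +-*-Solver

    ∣-∣≤⇒≥ : ∀ p q {ε} → ∣ p ℚ.- q ∣ ℚ.≤ ε → q ℚ.≤ p ℚ.+ ε
    ∣-∣≤⇒≥ p q {ε} h = ∣-∣≤⇒≤ q p (subst (ℚ._≤ ε)
      (trans (sym (ℚ.∣-p∣≡∣p∣ (p ℚ.- q)))
        (cong ∣_∣ (solve 2 (λ p q → :- (p :- q) := q :- p) refl p q))) h)
      where open +-*-Solver

    ≤⇒∣-∣≤ : ∀ p q {ε} → p ℚ.≤ q ℚ.+ ε → q ℚ.≤ p ℚ.+ ε → ∣ p ℚ.- q ∣ ℚ.≤ ε
    ≤⇒∣-∣≤ p q {ε} h₁ h₂ with ℚ.∣p∣≡p∨∣p∣≡-p (p ℚ.- q)
    ... | inj₁ eq = subst₂ ℚ._≤_ (sym eq)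
      (solve 2 (λ q ε → (q :+ ε) :- q := ε) refl q ε) (ℚ.+-monoˡ-≤ (ℚ.- q) h₁)
      where open +-*-Solver
    ... | inj₂ eq = subst₂ ℚ._≤_
      (trans (solve 2 (λ p q → q :- p := :- (p :- q)) refl p q) (sym eq))
      (solve 2 (λ p ε → (p :+ ε) :- p := ε) refl p ε) (ℚ.+-monoˡ-≤ (ℚ.- p) h₂)
      where open +-*-Solver

    halves : ∀ ε → ½ ℚ.* ε ℚ.+ ½ ℚ.* ε ≡ ε
    halves = solve 1 (λ ε → con ½ :* ε :+ con ½ :* ε := ε) refl
      where open +-*-Solver

    half-pos : ∀ {ε} → 0ℚ ℚ.< ε → 0ℚ ℚ.< ½ ℚ.* ε
    half-pos {ε} 0<ε = ℚ.*-monoʳ-<-pos ½ 0<ε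

    shrink : ∀ b ε → 0ℚ ℚ.< b → 0ℚ ℚ.< ε → ∃ λ δ → 0ℚ ℚ.< δ × b ℚ.* δ ≡ ε
    shrink b ε 0<b 0<ε = go {{ℚ.positive 0<b}}
      where
      open ≡-Reasoning
      go : {{ℚ.Positive b}} → ∃ λ δ → 0ℚ ℚ.< δ × b ℚ.* δ ≡ ε
      go {{b-pos}} = δ , 0<δ , bδ≡ε
        where
        instance
          b≢0 : ℚ.NonZero b
          b≢0 = ℚ.pos⇒nonZero b
          b⁻¹-pos : ℚ.Positive (ℚ.1/ b)
          b⁻¹-pos = ℚ.1/pos⇒pos b
        δ : ℚ
        δ = ℚ.1/ b ℚ.* ε
        0<δ : 0ℚ ℚ.< ℚ.1/ b ℚ.* ε
        0<δ = subst (ℚ._< ℚ.1/ b ℚ.* ε) (ℚ.*-zeroʳ (ℚ.1/ b))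
          (ℚ.*-monoʳ-<-pos (ℚ.1/ b) 0<ε)
        bδ≡ε : b ℚ.* (ℚ.1/ b ℚ.* ε) ≡ ε
        bδ≡ε = begin
          b ℚ.* (ℚ.1/ b ℚ.* ε)  ≡⟨ ℚ.*-assoc b (ℚ.1/ b) ε ⟨
          (b ℚ.* ℚ.1/ b) ℚ.* ε  ≡⟨ cong (ℚ._* ε) (ℚ.*-inverseʳ b) ⟩
          1ℚ ℚ.* ε              ≡⟨ ℚ.*-identityˡ ε ⟩
          ε                     ∎

    eventually-bounded : ∀ {x} → IsCauchy x →
      ∃ λ b → 0ℚ ℚ.< b × ∃ λ N → ∀ k → N ℕ.≤ k → ∣ x k ∣ ℚ.≤ b
    eventually-bounded {x} cx with cx 1ℚ (ℚ.positive⁻¹ 1ℚ)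
    ... | N , h =
      ∣ x N ∣ ℚ.+ 1ℚ
      , ℚ.+-mono-≤-< (ℚ.0≤∣p∣ (x N)) (ℚ.positive⁻¹ 1ℚ)
      , N
      , λ k N≤k → subst (λ r → ∣ r ∣ ℚ.≤ ∣ x N ∣ ℚ.+ 1ℚ)
          (solve 2 (λ a b → a :+ (b :- a) := b) refl (x N) (x k))
          (ℚ.≤-trans (ℚ.∣p+q∣≤∣p∣+∣q∣ (x N) (x k ℚ.- x N))
            (ℚ.+-monoʳ-≤ ∣ x N ∣ (h k N N≤k ℕ.≤-refl)))
      where open +-*-Solver

    const-cauchy : ∀ p → IsCauchy (λ _ → p)
    const-cauchy p ε 0<ε = 0 , λ _ _ _ _ →
      subst (λ r → ∣ r ∣ ℚ.≤ ε) (sym (ℚ.+-inverseʳ p)) (ℚ.<⇒≤ 0<ε)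

    +-close : ∀ a b c d {ε δ} → ∣ a ℚ.- c ∣ ℚ.≤ ε → ∣ b ℚ.- d ∣ ℚ.≤ δ →
      ∣ (a ℚ.+ b) ℚ.- (c ℚ.+ d) ∣ ℚ.≤ ε ℚ.+ δ
    +-close a b c d {ε} {δ} h₁ h₂ = subst (λ r → ∣ r ∣ ℚ.≤ ε ℚ.+ δ)
      (solve 4 (λ a b c d → (a :- c) :+ (b :- d) := (a :+ b) :- (c :+ d))
        refl a b c d)
      (ℚ.≤-trans (ℚ.∣p+q∣≤∣p∣+∣q∣ (a ℚ.- c) (b ℚ.- d)) (ℚ.+-mono-≤ h₁ h₂))
      where open +-*-Solver

    *-bound : ∀ p q {c δ} → 0ℚ ℚ.< c → ∣ p ∣ ℚ.≤ c → ∣ q ∣ ℚ.≤ δ →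
      ∣ p ℚ.* q ∣ ℚ.≤ c ℚ.* δ
    *-bound p q {c} {δ} 0<c hp hq =
      subst (ℚ._≤ c ℚ.* δ) (sym (ℚ.∣p*q∣≡∣p∣*∣q∣ p q))
        (ℚ.≤-trans
          (ℚ.*-monoʳ-≤-nonNeg ∣ q ∣ {{ℚ.∣-∣-nonNeg q}} hp)
          (ℚ.*-monoˡ-≤-nonNeg c {{ℚ.nonNegative (ℚ.<⇒≤ 0<c)}} hq))

    *-close : ∀ p q r s {a b δ η} → 0ℚ ℚ.< a → 0ℚ ℚ.< b →
      ∣ p ∣ ℚ.≤ a → ∣ q ℚ.- s ∣ ℚ.≤ δ → ∣ s ∣ ℚ.≤ b → ∣ p ℚ.- r ∣ ℚ.≤ η →
      ∣ p ℚ.* q ℚ.- r ℚ.* s ∣ ℚ.≤ a ℚ.* δ ℚ.+ b ℚ.* η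
    *-close p q r s {a} {b} {δ} {η} 0<a 0<b hp hqs hs hpr =
      subst (λ t → ∣ t ∣ ℚ.≤ a ℚ.* δ ℚ.+ b ℚ.* η)
        (solve 4 (λ p q r s → p :* (q :- s) :+ s :* (p :- r) := p :* q :- r :* s)
          refl p q r s)
        (ℚ.≤-trans
          (ℚ.∣p+q∣≤∣p∣+∣q∣ (p ℚ.* (q ℚ.- s)) (s ℚ.* (p ℚ.- r)))
          (ℚ.+-mono-≤ (*-bound p (q ℚ.- s) 0<a hp hqs)
                      (*-bound s (p ℚ.- r) 0<b hs hpr)))
      where open +-*-Solver

    +-cauchy : ∀ {x y} → IsCauchy x → IsCauchy y → IsCauchy (λ k → x k ℚ.+ y k)
    +-cauchy {x} {y} cx cy ε 0<ε =
      let M , f = cx (½ ℚ.* ε) (half-pos 0<ε)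
          N , g = cy (½ ℚ.* ε) (half-pos 0<ε)
      in M ℕ.⊔ N , λ k l hk hl →
        subst (∣ (x k ℚ.+ y k) ℚ.- (x l ℚ.+ y l) ∣ ℚ.≤_) (halves ε)
          (+-close (x k) (y k) (x l) (y l)
            (f k l (ℕ.m⊔n≤o⇒m≤o M N hk) (ℕ.m⊔n≤o⇒m≤o M N hl))
            (g k l (ℕ.m⊔n≤o⇒n≤o M N hk) (ℕ.m⊔n≤o⇒n≤o M N hl)))

    *-cauchy : ∀ {x y} → IsCauchy x → IsCauchy y → IsCauchy (λ k → x k ℚ.* y k)
    *-cauchy {x} {y} cx cy ε 0<ε =
      let a , 0<a , N₁ , ∣x∣≤a = eventually-bounded cx
          b , 0<b , N₂ , ∣y∣≤b = eventually-bounded cy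
          δ , 0<δ , aδ = shrink a (½ ℚ.* ε) 0<a (half-pos 0<ε)
          η , 0<η , bη = shrink b (½ ℚ.* ε) 0<b (half-pos 0<ε)
          N₃ , g = cy δ 0<δ
          N₄ , f = cx η 0<η
      in combine 0<a 0<b (trans (cong₂ ℚ._+_ aδ bη) (halves ε))
           N₁ N₂ N₃ N₄ ∣x∣≤a ∣y∣≤b g f
      where
      combine : ∀ {a b δ η} → 0ℚ ℚ.< a → 0ℚ ℚ.< b →
        a ℚ.* δ ℚ.+ b ℚ.* η ≡ ε → ∀ N₁ N₂ N₃ N₄ →
        (∀ k → N₁ ℕ.≤ k → ∣ x k ∣ ℚ.≤ a) →
        (∀ k → N₂ ℕ.≤ k → ∣ y k ∣ ℚ.≤ b) →
        (∀ k l → N₃ ℕ.≤ k → N₃ ℕ.≤ l → ∣ y k ℚ.- y l ∣ ℚ.≤ δ) →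
        (∀ k l → N₄ ℕ.≤ k → N₄ ℕ.≤ l → ∣ x k ℚ.- x l ∣ ℚ.≤ η) →
        ∃ λ N → ∀ k l → N ℕ.≤ k → N ℕ.≤ l → ∣ x k ℚ.* y k ℚ.- x l ℚ.* y l ∣ ℚ.≤ ε
      combine 0<a 0<b eq N₁ N₂ N₃ N₄ ∣x∣≤a ∣y∣≤b g f =
        M ℕ.⊔ N , λ k l hk hl →
          let k≥M = ℕ.m⊔n≤o⇒m≤o M N hk
              k≥N = ℕ.m⊔n≤o⇒n≤o M N hk
              l≥M = ℕ.m⊔n≤o⇒m≤o M N hl
              l≥N = ℕ.m⊔n≤o⇒n≤o M N hl
          in subst (∣ x k ℚ.* y k ℚ.- x l ℚ.* y l ∣ ℚ.≤_) eq
            (*-close (x k) (y k) (x l) (y l) 0<a 0<b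
              (∣x∣≤a k (ℕ.m⊔n≤o⇒m≤o N₁ N₂ k≥M))
              (g k l (ℕ.m⊔n≤o⇒m≤o N₃ N₄ k≥N) (ℕ.m⊔n≤o⇒m≤o N₃ N₄ l≥N))
              (∣y∣≤b l (ℕ.m⊔n≤o⇒n≤o N₁ N₂ l≥M))
              (f k l (ℕ.m⊔n≤o⇒n≤o N₃ N₄ k≥N) (ℕ.m⊔n≤o⇒n≤o N₃ N₄ l≥N)))
        where
        M N : ℕ
        M = N₁ ℕ.⊔ N₂
        N = N₃ ℕ.⊔ N₄

    ⊔-close : ∀ a b c d {ε} → ∣ a ℚ.- c ∣ ℚ.≤ ε → ∣ b ℚ.- d ∣ ℚ.≤ ε →
      ∣ (a ℚ.⊔ b) ℚ.- (c ℚ.⊔ d) ∣ ℚ.≤ ε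
    ⊔-close a b c d {ε} h₁ h₂ = ≤⇒∣-∣≤ (a ℚ.⊔ b) (c ℚ.⊔ d)
      (ℚ.⊔-lub
        (ℚ.≤-trans (∣-∣≤⇒≤ a c h₁) (ℚ.+-monoˡ-≤ ε (ℚ.p≤p⊔q c d)))
        (ℚ.≤-trans (∣-∣≤⇒≤ b d h₂) (ℚ.+-monoˡ-≤ ε (ℚ.p≤q⊔p c d))))
      (ℚ.⊔-lub
        (ℚ.≤-trans (∣-∣≤⇒≥ a c h₁) (ℚ.+-monoˡ-≤ ε (ℚ.p≤p⊔q a b)))
        (ℚ.≤-trans (∣-∣≤⇒≥ b d h₂) (ℚ.+-monoˡ-≤ ε (ℚ.p≤q⊔p a b))))

    ⊔-cauchy : ∀ {x y} → IsCauchy x → IsCauchy y → IsCauchy (λ k → x k ℚ.⊔ y k)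
    ⊔-cauchy {x} {y} cx cy ε 0<ε =
      let M , f = cx ε 0<ε
          N , g = cy ε 0<ε
      in M ℕ.⊔ N , λ k l hk hl → ⊔-close (x k) (y k) (x l) (y l)
           (f k l (ℕ.m⊔n≤o⇒m≤o M N hk) (ℕ.m⊔n≤o⇒m≤o M N hl))
           (g k l (ℕ.m⊔n≤o⇒n≤o M N hk) (ℕ.m⊔n≤o⇒n≤o M N hl))

infixl 6 _+_ _⊔_
infixl 7 _*_

fromℚ : ℚ → ℝ
fromℚ p = mkℝ (λ _ → p) (const-cauchy p)

0ℝ 1ℝ : ℝ
0ℝ = fromℚ 0ℚ
1ℝ = fromℚ 1ℚ

_+_ _*_ _⊔_ : ℝ → ℝ → ℝ
x + y = mkℝ (λ k → seq x k ℚ.+ seq y k)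
            (+-cauchy {seq x} {seq y} (isCauchy x) (isCauchy y))
x * y = mkℝ (λ k → seq x k ℚ.* seq y k)
            (*-cauchy {seq x} {seq y} (isCauchy x) (isCauchy y))
x ⊔ y = mkℝ (λ k → seq x k ℚ.⊔ seq y k)
            (⊔-cauchy {seq x} {seq y} (isCauchy x) (isCauchy y))

∑ : ∀ {n} → Vector ℝ n → ℝ
∑ = foldr _+_ 0ℝ

max : ∀ {n} → Vector ℝ (suc n) → ℝ
max v = foldr _⊔_ (head v) (tail v)

-- Attained extrema, unique up to _≈_.  They are predicates because an index
-- attaining the extremum of a family of reals cannot in general be computed.
IsMinimum IsMaximum : {A : Set} → (A → ℝ) → ℝ → Set
IsMinimum f v = (∃ λ a → f a ≈ v) × (∀ a → v ≤ f a)
IsMaximum f v = (∃ λ a → f a ≈ v) × (∀ a → f a ≤ v)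

------------------------------------------------------------------------
-- Scheduling n jobs on m unrelated machines

-- Nonnegativity is not part of this type; every scenario in an interval
-- uncertainty set has it, because the lower bounds do.
Scenario : ℕ → ℕ → Set
Scenario m n = Vector (Vector ℝ n) m

record Schedule (m n : ℕ) : Set where
  field
    part        : Vector (Subset n) m
    isPartition : ∀ j → ∃! _≡_ (λ i → j ∈ˢ part i)

open Schedule public

load : ∀ {m n} → Schedule m n → Scenario m n → Fin m → ℝ
load S q i = ∑ (λ j → if lookup (part S i) j then q i j else 0ℝ)

Cmax : ∀ {m n} → Schedule (suc m) n → Scenario (suc m) n → ℝ
Cmax S q = max (load S q)

IsOPT : ∀ {m n} → Scenario (suc m) n → ℝ → Set
IsOPT q = IsMinimum (λ S → Cmax S q)

-- v = min_S max_{q ∈ U} Cmax S q, with w S the inner maximum.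
IsOPTrob : ∀ {m n} → Pred (Scenario (suc m) n) 0ℓ → ℝ → Set
IsOPTrob {m} {n} U v = ∃ λ (w : Schedule (suc m) n → ℝ) →
  (∀ S → IsMaximum {A = ∃ (_∈ U)} (λ q → Cmax S (proj₁ q)) (w S)) ×
  IsMinimum w v

record IntervalInstance (m n : ℕ) : Set where
  field
    q⁻ q⁺ : Scenario m n
    0≤q⁻  : ∀ i j → 0ℝ ≤ q⁻ i j
    q⁻≤q⁺ : ∀ i j → q⁻ i j ≤ q⁺ i j

  𝒰 : Pred (Scenario m n) 0ℓ
  𝒰 q = ∀ i j → q⁻ i j ≤ q i j × q i j ≤ q⁺ i j

  field
    q̂   : Scenario m n
    q̂∈𝒰 : q̂ ∈ 𝒰

-- A probability distribution on the (finite) set of schedules, given as a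
-- finite list of schedules with weights.  A schedule may be listed more than
-- once, its probability then being the sum of its weights.
record RandomSchedule (m n : ℕ) : Set where
  field
    size     : ℕ
    schedule : Vector (Schedule m n) size
    weight   : Vector ℝ size
    0≤weight : ∀ k → 0ℝ ≤ weight k
    ∑weight  : ∑ weight ≈ 1ℝ

𝔼[Cmax] : ∀ {m n} → RandomSchedule (suc m) n → Scenario (suc m) n → ℝ
𝔼[Cmax] R q = ∑ (λ k → weight k * Cmax (schedule k) q)
  where open RandomSchedule R

{-# OPTIONS --safe #-}

-- On machine 0 the job takes between 0 and L = 1 + B time units, where B ≥ β,
-- and 0 is predicted; on machine 1 it always takes one unit.  Then OPT(q̂) = 0
-- and OPTrob = 1.  On both machines Cmax(q⁺) + B Cmax(q̂) = L, so in expectation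
-- E⁺ + B Ê = L as well.  Consistency forces Ê ≤ 0, hence E⁺ ≥ 1 + B > β,
-- contradicting robustness.

module Submission where

open import Defs
open import Data.Product using (Σ-syntax; ∃-syntax; _×_)
open import Relation.Nullary using (¬_)
open import Relation.Unary using (_∈_)
open IntervalInstance

open import Data.Bool.Base using (true; false; if_then_else_)
open import Data.Empty using (⊥)
open import Data.Fin.Base using (Fin; zero; suc)
open import Data.Fin.Properties using (_≟_)
open import Data.Fin.Subset using () renaming (_∈_ to _∈ˢ_)
open import Data.Nat.Base as ℕ using (ℕ)
import Data.Integer.Base as ℤ
import Data.Nat.Properties as ℕ
open import Data.Product.Base using (_,_; proj₁; proj₂)
open import Data.Rational.Base as ℚ using (ℚ; 0ℚ; 1ℚ; ½; ∣_∣)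
import Data.Rational.Properties as ℚ
open import Data.Rational.Solver using (module +-*-Solver)
open import Data.Sum.Base using (inj₁; inj₂)
open import Data.Vec.Base using ([]; _∷_; lookup; here)
open import Data.Vec.Functional using (Vector; foldr; head; tail)
open import Data.Vec.Properties using ([]=⇒lookup; lookup⇒[]=)
open import Relation.Binary.PropositionalEquality
  using (_≡_; refl; sym; trans; cong; cong₂; subst; module ≡-Reasoning)
open import Relation.Nullary using (does; yes; no; contradiction)

-- The order on the reals: comparison and monotone operations.

pointwise⇒≤ : ∀ {x y} → (∀ k → seq x k ℚ.≤ seq y k) → x ≤ y
pointwise⇒≤ {x} {y} h ε 0<ε = 0 , λ k _ →
  subst (ℚ._≤ seq y k ℚ.+ ε) (ℚ.+-identityʳ (seq x k))
    (ℚ.+-mono-≤ (h k) (ℚ.<⇒≤ 0<ε))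

pointwise⇒≈ : ∀ {x y} → (∀ k → seq x k ≡ seq y k) → x ≈ y
pointwise⇒≈ {x} {y} h =
  pointwise⇒≤ {x} {y} (λ k → ℚ.≤-reflexive (h k)) ,
  pointwise⇒≤ {y} {x} (λ k → ℚ.≤-reflexive (sym (h k)))

≤-refl : ∀ {x} → x ≤ x
≤-refl {x} = pointwise⇒≤ {x} {x} (λ _ → ℚ.≤-refl)

fromℚ-mono-≤ : ∀ {p q} → p ℚ.≤ q → fromℚ p ≤ fromℚ q
fromℚ-mono-≤ {p} {q} p≤q = pointwise⇒≤ {fromℚ p} {fromℚ q} (λ _ → p≤q)

+-mono-≤ : ∀ {x y u v} → x ≤ y → u ≤ v → x + u ≤ y + v
+-mono-≤ {x} {y} {u} {v} x≤y u≤v ε 0<ε =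
  let δ   = ½ ℚ.* ε
      0<δ = ℚ.*-monoʳ-<-pos ½ 0<ε
      M , f = x≤y δ 0<δ
      N , g = u≤v δ 0<δ
  in M ℕ.⊔ N , λ k h → subst (seq x k ℚ.+ seq u k ℚ.≤_)
       (solve 3 (λ a b e → (a :+ con ½ :* e) :+ (b :+ con ½ :* e) := (a :+ b) :+ e)
         refl (seq y k) (seq v k) ε)
       (ℚ.+-mono-≤ (f k (ℕ.m⊔n≤o⇒m≤o M N h)) (g k (ℕ.m⊔n≤o⇒n≤o M N h)))
  where open +-*-Solver

⊔-mono-≤ : ∀ {x y u v} → x ≤ y → u ≤ v → x ⊔ u ≤ y ⊔ v
⊔-mono-≤ {x} {y} {u} {v} x≤y u≤v ε 0<ε =
  let M , f = x≤y ε 0<ε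
      N , g = u≤v ε 0<ε
  in M ℕ.⊔ N , λ k h → ℚ.⊔-lub
       (ℚ.≤-trans (f k (ℕ.m⊔n≤o⇒m≤o M N h))
         (ℚ.+-monoˡ-≤ ε (ℚ.p≤p⊔q (seq y k) (seq v k))))
       (ℚ.≤-trans (g k (ℕ.m⊔n≤o⇒n≤o M N h))
         (ℚ.+-monoˡ-≤ ε (ℚ.p≤q⊔p (seq y k) (seq v k))))

-- Monotonicity of sums, maxima and makespans.

∑-mono-≤ : ∀ {n} {v w : Vector ℝ n} → (∀ i → v i ≤ w i) → ∑ v ≤ ∑ w
∑-mono-≤ {ℕ.zero}          _   = ≤-refl {0ℝ}
∑-mono-≤ {ℕ.suc n} {v} {w} v≤w =
  +-mono-≤ {head v} {head w} {∑ (tail v)} {∑ (tail w)}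
    (v≤w zero) (∑-mono-≤ (λ i → v≤w (suc i)))

max-mono-≤ : ∀ {n} {v w : Vector ℝ (ℕ.suc n)} → (∀ i → v i ≤ w i) → max v ≤ max w
max-mono-≤ {v = v} {w} v≤w = go (v≤w zero) (λ i → v≤w (suc i))
  where
  -- `max` folds the tail with the head as start value, so the induction runs over the tail alone
  -- and carries the comparison of the start values along.
  go : ∀ {n} {x y} {v w : Vector ℝ n} → x ≤ y → (∀ i → v i ≤ w i) →
    foldr _⊔_ x v ≤ foldr _⊔_ y w
  go {ℕ.zero}                  x≤y _   = x≤y
  go {ℕ.suc n} {x} {y} {v} {w} x≤y v≤w =
    ⊔-mono-≤ {head v} {head w} {foldr _⊔_ x (tail v)} {foldr _⊔_ y (tail w)}
      (v≤w zero) (go x≤y (λ i → v≤w (suc i)))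

-- This makes the scenario of all upper bounds a worst case for every schedule at once.
Cmax-mono-≤ : ∀ {m n} (S : Schedule (ℕ.suc m) n) {q r : Scenario (ℕ.suc m) n} →
  (∀ i j → q i j ≤ r i j) → Cmax S q ≤ Cmax S r
Cmax-mono-≤ {n = n} S {q} {r} q≤r = max-mono-≤ {v = load S q} {load S r}
  (λ i → ∑-mono-≤ {v = entries q i} {entries r i} (term i))
  where
  entries : Scenario _ n → Fin _ → Vector ℝ n
  entries q i j = if lookup (part S i) j then q i j else 0ℝ
  term : ∀ i j → entries q i j ≤ entries r i j
  term i j with lookup (part S i) j
  ... | true  = q≤r i j
  ... | false = ≤-refl {0ℝ}

-- Rational upper bounds of reals.

p≤∣p∣ : ∀ p → p ℚ.≤ ∣ p ∣
p≤∣p∣ p with ℚ.≤-total 0ℚ p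
... | inj₁ 0≤p = ℚ.≤-reflexive (sym (ℚ.0≤p⇒∣p∣≡p 0≤p))
... | inj₂ p≤0 = ℚ.≤-trans p≤0 (ℚ.0≤∣p∣ p)

-- From the Cauchy index `N` for tolerance 1 onwards, every term lies within 1 of `seq x N`.
bounded-above : ∀ x → ∃[ b ] 0ℚ ℚ.≤ b × x ≤ fromℚ b
bounded-above x with isCauchy x 1ℚ (ℚ.positive⁻¹ 1ℚ)
... | N , h = b , 0≤b , λ ε 0<ε → N , λ k N≤k →
  ℚ.≤-trans (bound k (h k N N≤k ℕ.≤-refl))
    (subst (ℚ._≤ b ℚ.+ ε) (ℚ.+-identityʳ b) (ℚ.+-monoʳ-≤ b (ℚ.<⇒≤ 0<ε)))
  where
  open +-*-Solver
  b : ℚ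
  b = ∣ seq x N ∣ ℚ.+ 1ℚ
  0≤b : 0ℚ ℚ.≤ b
  0≤b = ℚ.+-mono-≤ (ℚ.0≤∣p∣ (seq x N)) (ℚ.<⇒≤ (ℚ.positive⁻¹ 1ℚ))
  bound : ∀ k → ∣ seq x k ℚ.- seq x N ∣ ℚ.≤ 1ℚ → seq x k ℚ.≤ b
  bound k close = subst (ℚ._≤ b)
    (solve 2 (λ a c → c :+ (a :- c) := a) refl (seq x k) (seq x N))
    (ℚ.+-mono-≤ (p≤∣p∣ (seq x N)) (ℚ.≤-trans (p≤∣p∣ (seq x k ℚ.- seq x N)) close))

-- Schedules of a single job.

machine : ∀ {m n} → Schedule m n → Fin n → Fin m
machine S j = proj₁ (isPartition S j)

onMachine : ∀ {m} → Fin m → Schedule m 1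
onMachine i = record
  { part        = λ k → does (i ≟ k) ∷ []
  ; isPartition = λ { zero → i , in-part , unique }
  }
  where
  in-part : zero ∈ˢ (does (i ≟ i) ∷ [])
  in-part with i ≟ i
  ... | yes _   = here
  ... | no  i≢i = contradiction refl i≢i
  unique : ∀ {k} → zero ∈ˢ (does (i ≟ k) ∷ []) → i ≡ k
  unique {k} k∋0 with i ≟ k
  ... | yes i≡k = i≡k
  unique {k} () | no _

-- The maximum with 0ℚ is the load of the idle machine.
Cmax-single : ∀ (S : Schedule 2 1) q k →
  seq (Cmax S q) k ≡ seq (q (machine S zero) zero) k ℚ.⊔ 0ℚ
Cmax-single S q k = go (machine S zero)
  (proj₁ (proj₂ (isPartition S zero))) (proj₂ (proj₂ (isPartition S zero)))
  where
  busy : ∀ {i} → zero ∈ˢ part S i → seq (load S q i) k ≡ seq (q i zero) k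
  busy {i} i∋0 with lookup (part S i) zero | []=⇒lookup i∋0
  ... | true | refl = ℚ.+-identityʳ (seq (q i zero) k)

  idle : ∀ {i} → ¬ (zero ∈ˢ part S i) → seq (load S q i) k ≡ 0ℚ
  idle {i} i∌0 with lookup (part S i) zero in eq
  ... | true  = contradiction (lookup⇒[]= zero (part S i) eq) i∌0
  ... | false = refl

  go : ∀ i → zero ∈ˢ part S i → (∀ {i′} → zero ∈ˢ part S i′ → i ≡ i′) →
    seq (Cmax S q) k ≡ seq (q i zero) k ℚ.⊔ 0ℚ
  -- `max` unfolds to the load of machine 1 `⊔` the load of machine 0, so here the idle machine
  -- stands first.
  go zero i∋0 unique = trans
    (cong₂ ℚ._⊔_ (idle (λ h → contradiction (unique h) λ ())) (busy i∋0))
    (ℚ.⊔-comm 0ℚ (seq (q zero zero) k))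
  go (suc zero) i∋0 unique =
    cong₂ ℚ._⊔_ (busy i∋0) (idle (λ h → contradiction (unique h) λ ()))

-- The extreme scenarios.

-- One family covers both ends of the uncertainty set: parameter 0 gives the lower bounds and the
-- prediction, parameter L the upper bounds.
times : ℚ → Scenario 2 1
times p zero    _ = fromℚ p
times p (suc _) _ = 1ℝ

times-mono-≤ : ∀ {p q} → p ℚ.≤ q → ∀ i j → times p i j ≤ times q i j
times-mono-≤ p≤q zero    _ = fromℚ-mono-≤ p≤q
times-mono-≤ p≤q (suc _) _ = ≤-refl {1ℝ}

0≤times : ∀ {p} → 0ℚ ℚ.≤ p → ∀ i j k → 0ℚ ℚ.≤ seq (times p i j) k
0≤times 0≤p zero    _ _ = 0≤p
0≤times 0≤p (suc _) _ _ = ℚ.<⇒≤ (ℚ.positive⁻¹ 1ℚ)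

-- The idle machine drops out because processing times are nonnegative. The equality is exact at
-- each index, so later computations take place in ℚ.
Cmax-times : ∀ {p} → 0ℚ ℚ.≤ p → ∀ (S : Schedule 2 1) k →
  seq (Cmax S (times p)) k ≡ seq (times p (machine S zero) zero) k
Cmax-times {p} 0≤p S k = trans (Cmax-single S (times p) k)
  (ℚ.p≥q⇒p⊔q≡p (0≤times 0≤p (machine S zero) zero k))

-- The tradeoff in expectation.

-- Linearity of expectation: an identity that holds for every listed schedule survives weighting.
-- The total weight stays on the right as a factor, since weights summing to 1 up to `≈` need not do
-- so at a fixed index.
∑-tradeoff : ∀ b k {n} (w x y : Vector ℝ n) →
  (∀ i → seq (x i) k ℚ.+ b ℚ.* seq (y i) k ≡ 1ℚ ℚ.+ b) →
  seq (∑ (λ i → w i * x i)) k ℚ.+ b ℚ.* seq (∑ (λ i → w i * y i)) k ≡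
  (1ℚ ℚ.+ b) ℚ.* seq (∑ w) k
∑-tradeoff b k {ℕ.zero}  w x y h =
  solve 1 (λ b → con 0ℚ :+ b :* con 0ℚ := (con 1ℚ :+ b) :* con 0ℚ) refl b
  where open +-*-Solver
∑-tradeoff b k {ℕ.suc n} w x y h = begin
  (W ℚ.* X ℚ.+ ΣX) ℚ.+ b ℚ.* (W ℚ.* Y ℚ.+ ΣY)
    ≡⟨ solve 6 (λ b w x y s t → (w :* x :+ s) :+ b :* (w :* y :+ t) :=
         (x :+ b :* y) :* w :+ (s :+ b :* t)) refl b W X Y ΣX ΣY ⟩
  (X ℚ.+ b ℚ.* Y) ℚ.* W ℚ.+ (ΣX ℚ.+ b ℚ.* ΣY)
    ≡⟨ cong₂ ℚ._+_ (cong (ℚ._* W) (h zero))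
         (∑-tradeoff b k (tail w) (tail x) (tail y) (λ i → h (suc i))) ⟩
  (1ℚ ℚ.+ b) ℚ.* W ℚ.+ (1ℚ ℚ.+ b) ℚ.* seq (∑ (tail w)) k
    ≡⟨ ℚ.*-distribˡ-+ (1ℚ ℚ.+ b) W (seq (∑ (tail w)) k) ⟨
  (1ℚ ℚ.+ b) ℚ.* (W ℚ.+ seq (∑ (tail w)) k) ∎
  where
  open ≡-Reasoning
  open +-*-Solver
  W X Y ΣX ΣY : ℚ
  W  = seq (head w) k
  X  = seq (head x) k
  Y  = seq (head y) k
  ΣX = seq (∑ (λ i → tail w i * tail x i)) k
  ΣY = seq (∑ (λ i → tail w i * tail y i)) k

-- The total slack (3 + 2b)ε is chosen to be ½.
tradeoff-contradiction : ∀ b α β e⁺ ê s → 0ℚ ℚ.≤ b → β ≤ fromℚ b →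
  (∀ k → seq e⁺ k ℚ.+ b ℚ.* seq ê k ≡ (1ℚ ℚ.+ b) ℚ.* seq s k) →
  1ℝ ≤ s → ê ≤ α * 0ℝ → e⁺ ≤ β * 1ℝ → ⊥
tradeoff-contradiction b α β e⁺ ê s 0≤b β≤b eq 1≤s ê≤ e⁺≤ =
  let N₁ , h₁ = β≤b ε 0<ε
      N₂ , h₂ = 1≤s ε 0<ε
      N₃ , h₃ = ê≤ ε 0<ε
      N₄ , h₄ = e⁺≤ ε 0<ε
      k = (N₁ ℕ.⊔ N₂) ℕ.⊔ (N₃ ℕ.⊔ N₄)
      k₁₂ = ℕ.m≤m⊔n (N₁ ℕ.⊔ N₂) (N₃ ℕ.⊔ N₄)
      k₃₄ = ℕ.m≤n⊔m (N₁ ℕ.⊔ N₂) (N₃ ℕ.⊔ N₄)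
  in absurd k
       (h₁ k (ℕ.m⊔n≤o⇒m≤o N₁ N₂ k₁₂)) (h₂ k (ℕ.m⊔n≤o⇒n≤o N₁ N₂ k₁₂))
       (h₃ k (ℕ.m⊔n≤o⇒m≤o N₃ N₄ k₃₄)) (h₄ k (ℕ.m⊔n≤o⇒n≤o N₃ N₄ k₃₄))
  where
  open +-*-Solver
  instance
    b-nonNeg : ℚ.NonNegative b
    b-nonNeg = ℚ.nonNegative 0≤b
    1+b-nonNeg : ℚ.NonNegative (1ℚ ℚ.+ b)
    1+b-nonNeg = ℚ.nonNeg+nonNeg⇒nonNeg 1ℚ b
  c : ℚ
  c = (1ℚ ℚ.+ 1ℚ ℚ.+ 1ℚ) ℚ.+ (b ℚ.+ b)
  instance
    c-pos : ℚ.Positive c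
    c-pos = ℚ.pos+nonNeg⇒pos (1ℚ ℚ.+ 1ℚ ℚ.+ 1ℚ) (b ℚ.+ b)
              {{ℚ.nonNeg+nonNeg⇒nonNeg b b}}
    c≢0 : ℚ.NonZero c
    c≢0 = ℚ.pos⇒nonZero c
    c⁻¹-pos : ℚ.Positive (ℚ.1/ c)
    c⁻¹-pos = ℚ.1/pos⇒pos c
  ε : ℚ
  ε = ½ ℚ.* ℚ.1/ c
  0<ε : 0ℚ ℚ.< ε
  0<ε = ℚ.*-monoʳ-<-pos ½ (ℚ.positive⁻¹ (ℚ.1/ c))
  cε≡½ : c ℚ.* ε ≡ ½
  cε≡½ = trans (solve 2 (λ c d → c :* (con ½ :* d) := con ½ :* (c :* d)) refl c (ℚ.1/ c))
    (cong (½ ℚ.*_) (ℚ.*-inverseʳ c))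

  -- Everything is compared at one index. Robustness and `β ≤ b` together cost 2ε, consistency
  -- weighted by `b` costs bε, and a total weight that may fall short of 1 by ε costs (1 + b)ε.
  absurd : ∀ k → seq β k ℚ.≤ b ℚ.+ ε → 1ℚ ℚ.≤ seq s k ℚ.+ ε →
    seq ê k ℚ.≤ seq α k ℚ.* 0ℚ ℚ.+ ε → seq e⁺ k ℚ.≤ seq β k ℚ.* 1ℚ ℚ.+ ε → ⊥
  absurd k hβ hs hê he⁺ = ℚ.<-irrefl refl (begin-strict
    1ℚ ℚ.+ b                                ≡⟨ ℚ.*-identityʳ (1ℚ ℚ.+ b) ⟨
    (1ℚ ℚ.+ b) ℚ.* 1ℚ                       ≤⟨ ℚ.*-monoˡ-≤-nonNeg (1ℚ ℚ.+ b) hs ⟩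
    (1ℚ ℚ.+ b) ℚ.* (seq s k ℚ.+ ε)          ≡⟨ ℚ.*-distribˡ-+ (1ℚ ℚ.+ b) (seq s k) ε ⟩
    (1ℚ ℚ.+ b) ℚ.* seq s k ℚ.+ slack        ≡⟨ cong (ℚ._+ slack) (eq k) ⟨
    (seq e⁺ k ℚ.+ b ℚ.* seq ê k) ℚ.+ slack  ≤⟨ ℚ.+-monoˡ-≤ slack
                                                 (ℚ.+-mono-≤ e⁺-bound
                                                   (ℚ.*-monoˡ-≤-nonNeg b ê-bound)) ⟩
    ((b ℚ.+ ε) ℚ.+ ε ℚ.+ b ℚ.* ε) ℚ.+ slack
      ≡⟨ solve 2 (λ b e →
           ((b :+ e) :+ e :+ b :* e) :+ (con 1ℚ :+ b) :* e :=
           b :+ ((con 1ℚ :+ con 1ℚ :+ con 1ℚ) :+ (b :+ b)) :* e) refl b ε ⟩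
    b ℚ.+ c ℚ.* ε                           ≡⟨ cong (b ℚ.+_) cε≡½ ⟩
    -- ½ < 1 is checked by cross-multiplication, where it reads 1 < 2.
    b ℚ.+ ½                                 <⟨ ℚ.+-monoʳ-< b (ℚ.*<* (ℤ.+<+ ℕ.≤-refl)) ⟩
    b ℚ.+ 1ℚ                                ≡⟨ ℚ.+-comm b 1ℚ ⟩
    1ℚ ℚ.+ b                                ∎)
    where
    open ℚ.≤-Reasoning
    slack : ℚ
    slack = (1ℚ ℚ.+ b) ℚ.* ε
    e⁺-bound : seq e⁺ k ℚ.≤ (b ℚ.+ ε) ℚ.+ ε
    e⁺-bound = ℚ.≤-trans he⁺ (ℚ.+-monoˡ-≤ ε
      (subst (ℚ._≤ b ℚ.+ ε) (sym (ℚ.*-identityʳ (seq β k))) hβ))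
    -- Since the predicted optimum is 0, the factor `α` disappears, however large it is.
    ê-bound : seq ê k ℚ.≤ ε
    ê-bound = subst (seq ê k ℚ.≤_)
      (trans (cong (ℚ._+ ε) (ℚ.*-zeroʳ (seq α k))) (ℚ.+-identityˡ ε)) hê

-- The instance and its two optima.

instanceFor : ∀ {p} → 0ℚ ℚ.≤ p → IntervalInstance 2 1
instanceFor {p} 0≤p = record
  { q⁻    = times 0ℚ
  ; q⁺    = times p
  ; 0≤q⁻  = λ i j → pointwise⇒≤ {0ℝ} {times 0ℚ i j} (0≤times ℚ.≤-refl i j)
  ; q⁻≤q⁺ = times-mono-≤ 0≤p
  ; q̂     = times 0ℚ
  ; q̂∈𝒰   = λ i j → ≤-refl {times 0ℚ i j} , times-mono-≤ 0≤p i j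
  }

-- Machine 0 finishes the job in no time under the prediction.
instanceFor-OPT : ∀ {p} (0≤p : 0ℚ ℚ.≤ p) → IsOPT (q̂ (instanceFor 0≤p)) 0ℝ
instanceFor-OPT 0≤p =
  (onMachine zero ,
   pointwise⇒≈ {Cmax (onMachine zero) (times 0ℚ)} {0ℝ}
     (Cmax-times ℚ.≤-refl (onMachine zero))) ,
  λ S → pointwise⇒≤ {0ℝ} {Cmax S (times 0ℚ)} λ k →
    subst (0ℚ ℚ.≤_) (sym (Cmax-times ℚ.≤-refl S k))
      (0≤times ℚ.≤-refl (machine S zero) zero k)

-- By monotonicity the inner maximum is attained at `times p` for each schedule. It equals `p` on
-- machine 0 and 1 on machine 1, so `1 ≤ p` makes machine 1 the robust choice.
instanceFor-OPTrob : ∀ {p} (0≤p : 0ℚ ℚ.≤ p) → 1ℚ ℚ.≤ p →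
  IsOPTrob (𝒰 (instanceFor 0≤p)) 1ℝ
instanceFor-OPTrob {p} 0≤p 1≤p =
  worst ,
  (λ S → ((times p , λ i j → times-mono-≤ 0≤p i j , ≤-refl {times p i j}) ,
          pointwise⇒≈ {worst S} {worst S} (λ _ → refl)) ,
         (λ { (q , q∈𝒰) → Cmax-mono-≤ S {q} {times p} (λ i j → proj₂ (q∈𝒰 i j)) })) ,
  (onMachine (suc zero) ,
   pointwise⇒≈ {worst (onMachine (suc zero))} {1ℝ}
     (Cmax-times 0≤p (onMachine (suc zero)))) ,
  λ S → pointwise⇒≤ {1ℝ} {worst S} λ k →
    subst (1ℚ ℚ.≤_) (sym (Cmax-times 0≤p S k)) (1≤times (machine S zero) k)
  where
  worst : Schedule 2 1 → ℝ
  worst S = Cmax S (times p)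
  1≤times : ∀ i k → 1ℚ ℚ.≤ seq (times p i zero) k
  1≤times zero    _ = 1≤p
  1≤times (suc _) _ = ℚ.≤-refl

-- Impossibility for every random schedule.

-- Machine 0 contributes (1 + b) + b · 0 and machine 1 contributes 1 + b · 1: the weight `b` is
-- chosen so that the two agree.
times-tradeoff : ∀ {p b} (0≤p : 0ℚ ℚ.≤ p) → p ≡ 1ℚ ℚ.+ b → ∀ S k →
  seq (Cmax S (times p)) k ℚ.+ b ℚ.* seq (Cmax S (times 0ℚ)) k ≡ 1ℚ ℚ.+ b
times-tradeoff {p} {b} 0≤p p≡1+b S k = trans
  (cong₂ (λ x y → x ℚ.+ b ℚ.* y) (Cmax-times 0≤p S k) (Cmax-times ℚ.≤-refl S k))
  (on (machine S zero))
  where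
  on : ∀ i → seq (times p i zero) k ℚ.+ b ℚ.* seq (times 0ℚ i zero) k ≡ 1ℚ ℚ.+ b
  on zero    = trans (cong (p ℚ.+_) (ℚ.*-zeroʳ b)) (trans (ℚ.+-identityʳ p) p≡1+b)
  on (suc _) = cong (1ℚ ℚ.+_) (ℚ.*-identityʳ b)

not-consistent-and-robust : ∀ {p b} α β → 0ℚ ℚ.≤ p → p ≡ 1ℚ ℚ.+ b →
  0ℚ ℚ.≤ b → β ≤ fromℚ b → (R : RandomSchedule 2 1) →
  𝔼[Cmax] R (times 0ℚ) ≤ α * 0ℝ → 𝔼[Cmax] R (times p) ≤ β * 1ℝ → ⊥
not-consistent-and-robust {p} {b} α β 0≤p p≡1+b 0≤b β≤b R =
  tradeoff-contradiction b α β
    (𝔼[Cmax] R (times p)) (𝔼[Cmax] R (times 0ℚ)) (∑ weight) 0≤b β≤b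
    (λ k → ∑-tradeoff b k weight
      (λ i → Cmax (schedule i) (times p)) (λ i → Cmax (schedule i) (times 0ℚ))
      (λ i → times-tradeoff {b = b} 0≤p p≡1+b (schedule i) k))
    -- A total weight of at least 1 bounds the combined expectation from below by 1 + b.
    (proj₂ ∑weight)
  where open RandomSchedule R

no-algorithm : ∀ {p b} α β (0≤p : 0ℚ ℚ.≤ p) → p ≡ 1ℚ ℚ.+ b →
  0ℚ ℚ.≤ b → β ≤ fromℚ b →
  ¬ (Σ[ R ∈ RandomSchedule 2 1 ]
      (𝔼[Cmax] R (q̂ (instanceFor 0≤p)) ≤ α * 0ℝ) ×
      (∀ q → q ∈ 𝒰 (instanceFor 0≤p) → 𝔼[Cmax] R q ≤ β * 1ℝ))
no-algorithm {p} α β 0≤p p≡1+b 0≤b β≤b (R , consistent , robust) =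
  not-consistent-and-robust α β 0≤p p≡1+b 0≤b β≤b R consistent
    (robust (times p) (λ i j → times-mono-≤ 0≤p i j , ≤-refl {times p i j}))

theorem6 : (α β : ℝ) → 1ℝ ≤ α → 1ℝ ≤ β →
    Σ[ I ∈ IntervalInstance 2 1 ] ∃[ opt ] ∃[ optrob ]
    IsOPT (q̂ I) opt × IsOPTrob (𝒰 I) optrob ×
    ¬ (Σ[ R ∈ RandomSchedule 2 1 ]
    (𝔼[Cmax] R (q̂ I) ≤ α * opt) ×
    (∀ q → q ∈ 𝒰 I → 𝔼[Cmax] R q ≤ β * optrob))
theorem6 α β _ _ =
  -- Passing from `β` to a rational bound `b` makes every processing time of the instance a constant
  -- rational. The job length on machine 0 is then L = 1 + b, and `0≤b` yields 1 ≤ L.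
  let b , 0≤b , β≤b = bounded-above β
      1≤L = subst (ℚ._≤ 1ℚ ℚ.+ b) (ℚ.+-identityʳ 1ℚ) (ℚ.+-monoʳ-≤ 1ℚ 0≤b)
      0≤L = ℚ.≤-trans (ℚ.<⇒≤ (ℚ.positive⁻¹ 1ℚ)) 1≤L
  in instanceFor 0≤L , 0ℝ , 1ℝ , instanceFor-OPT 0≤L , instanceFor-OPTrob 0≤L 1≤L ,
     no-algorithm α β 0≤L refl 0≤b β≤b
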